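{- Let $n\in\mathbb{N}$ and let $\mathcal{L}$ be a finite set of rectangular polyominoes. If every element of $\mathcal{L}$ has height either $1$ or at least $n-1$, then $\mathcal{L}$ is $n$-representable. Furthermore, if $n=4$, then any finite set of rectangular polyominoes in which all of the polyominoes of height two have the same width is $n$-representable (i.e. $4$-representable).
   Context: $p_{a\times b}$ denotes the rectangular polyomino of height $a$ and width $b$, and $R_{n\times m}$ the rectangular region of height $n$ (rows numbered $1,\dots,n$) and width $m$. Let $I(n)$ be the set of non-empty contiguous intervals of $\{1,\dots,n\}$. A finite set $\mathcal{L}$ of rectangular polyominoes is $n$-representable if for every $m$ and every finite multiset $\mathcal{P}$ of pairs $(p_{a\times b},\iota)$ with $p_{a\times b}\in\mathcal{L}$ and $\iota\in I(n)$ having exactly $a$ elements, whenever $$\sum_{(p_{a\times b},\iota)\in\mathcal{P}}ab=nm\quad\text{and}\quad\sum_{(p_{a\times b},\iota)\in\mathcal{P},\ i\in\iota}b=m\ \text{ for all }1\le i\le n,$$ there is a tiling of $R_{n\times m}$ by translates of the polyominoes of $\mathcal{P}$ (covering every point, with no two-dimensional overlaps between different elements) in which each $(p_{a\times b},\iota)$ occupies exactly the rows in $\iota$. -}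

module Defs where

open import Data.Fin using (Fin)
open import Data.List using (List; length; lookup; map; sum; filter)
open import Data.List.Membership.Propositional using () renaming (_∈_ to _∈ˡ_)
open import Data.List.Relation.Unary.All using (All)
open import Data.Nat using (ℕ; suc; _+_; _*_; _∸_; _≤_; _≤?_; NonZero)
open import Data.Product using (_×_; _,_; proj₁; proj₂; ∃-syntax)
open import Function.Bundles using (_⇔_)
open import Level using (0ℓ)
open import Relation.Binary.PropositionalEquality using (_≡_; _≢_)
open import Relation.Nullary using (Dec)
open import Relation.Nullary.Decidable using (_×-dec_)
open import Relation.Unary using (Pred; _∈_; _≐_; _⊥_; ⋃)

-- The cell in row i and column j is (i , j); rows and columns are numbered
-- from 1.
Cell : Set
Cell = ℕ × ℕ

Region : ℕ → ℕ → Pred Cell 0ℓ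
Region n m (i , j) = (1 ≤ i × i ≤ n) × (1 ≤ j × j ≤ m)

record RectPolyomino : Set where
  constructor rect
  field
    height width        : ℕ
    .{{height-nonZero}} : NonZero height
    .{{width-nonZero}}  : NonZero width

open RectPolyomino public

cells : RectPolyomino → Pred Cell 0ℓ
cells p = Region (height p) (width p)

-- Since `cells p` has its corner at (1 , 1), its translates by natural
-- vectors are all its integer translates with positive coordinates.
translate : ℕ × ℕ → Pred Cell 0ℓ → Pred Cell 0ℓ
translate (r , c) S x = ∃[ i ] ∃[ j ] ((i , j) ∈ S × x ≡ (r + i , c + j))

-- The interval {first, …, last} ⊆ {1, …, n}, non-empty by first≤last.
record Interval (n : ℕ) : Set where
  constructor interval
  field
    first last : ℕ
    1≤first    : 1 ≤ first
    first≤last : first ≤ last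
    last≤n     : last ≤ n

open Interval public

infix 4 _∈ᴵ_ _∈ᴵ?_

_∈ᴵ_ : ∀ {n} → ℕ → Interval n → Set
i ∈ᴵ ι = first ι ≤ i × i ≤ last ι

_∈ᴵ?_ : ∀ {n} (i : ℕ) (ι : Interval n) → Dec (i ∈ᴵ ι)
i ∈ᴵ? ι = (first ι ≤? i) ×-dec (i ≤? last ι)

size : ∀ {n} → Interval n → ℕ
size ι = suc (last ι) ∸ first ι

Placement : ℕ → Set
Placement n = RectPolyomino × Interval n

-- A finite multiset of pairs is given by a list enumerating it with
-- multiplicity; the order of the list plays no role in what follows.
Multiset : Set → Set
Multiset = List

Admissible : ∀ {n} → List RectPolyomino → Placement n → Set
Admissible L (p , ι) = p ∈ˡ L × size ι ≡ height p

area : ∀ {n} → Multiset (Placement n) → ℕ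
area P = sum (map (λ (p , _) → height p * width p) P)

rowWidth : ∀ {n} → Multiset (Placement n) → ℕ → ℕ
rowWidth P i =
  sum (map (λ (p , _) → width p) (filter (λ (_ , ι) → i ∈ᴵ? ι) P))

-- Elements of the multiset are addressed by their position in the list, so
-- that repeated pairs are distinct tiles.
record Tiling (n m : ℕ) (P : Multiset (Placement n)) : Set where
  field
    shift : Fin (length P) → ℕ × ℕ

  tile : Fin (length P) → Pred Cell 0ℓ
  tile k = translate (shift k) (cells (proj₁ (lookup P k)))

  field
    covers   : ⋃ (Fin (length P)) tile ≐ Region n m
    disjoint : ∀ k l → k ≢ l → tile k ⊥ tile l
    rows     : ∀ k i → (∃[ j ] (i , j) ∈ tile k) ⇔ (i ∈ᴵ proj₂ (lookup P k))

-- A finite set of polyominoes is given by a list, used only through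
-- membership.
Representable : ℕ → List RectPolyomino → Set
Representable n L =
  ∀ (m : ℕ) (P : Multiset (Placement n)) →
  All (Admissible L) P →
  area P ≡ n * m →
  (∀ i → 1 ≤ i → i ≤ n → rowWidth P i ≡ m) →
  Tiling n m P

{-# OPTIONS --safe #-}

-- Build a stack from the left edge and a mirrored one from the right edge, each
-- tile going flush against the tiles already in its stack. If every tile meets a
-- flat part of its stack, then each stack is gap-free in every row, and the two
-- stacks meet exactly, because the row widths add up to m.
--
-- Heights 1 and ≥ n − 1: on the left the tiles of full height, then those on
-- rows 1 … n − 1, then the single rows; on the right the tiles on rows 2 … n.
--
-- n = 4: start on the left with the full tiles and with as many columns as
-- possible made of a tile on rows 1, 2 above one on rows 3, 4; these columns
-- exist because the widths agree. Only one of these two kinds remains, say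
-- that on rows 1, 2 (the other case is symmetric). It goes on the left after
-- the tiles on rows 1 … 3, while on the right the tiles on rows 2, 3 follow
-- those on rows 2 … 4.
module Submission where

open import Defs
open import Data.Nat using (ℕ; zero; suc; _+_; _∸_; _≤_; _<_; _≤?_; s≤s; z<s; >-nonZero⁻¹)
open import Data.Nat.Properties
open import Data.Nat.Tactic.RingSolver using (solve-∀)
open import Data.Nat.ListAction using (sum)
open import Data.Nat.ListAction.Properties using (sum-↭; sum-++)
open import Data.Fin using (Fin; zero; suc)
open import Data.List using (List; []; _∷_; _++_; map; filter; length; lookup)
open import Data.List.Properties
  using (map-∘; map-++; filter-accept; filter-reject; filter-++)
open import Data.List.Membership.Propositional using (_∈_)
open import Data.List.Relation.Binary.Permutation.Propositional
  using (_↭_; ↭-refl; ↭-sym; ↭-trans; ↭-reflexive; ↭-prep; ↭⇒↭ₛ)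
open import Data.List.Relation.Binary.Permutation.Propositional.Properties
  using (map⁺; filter-↭; ↭-map-inv; shift; ++⁺ˡ; ++⁺ʳ;
         ++-commutativeMonoid; All-resp-↭; Any-resp-↭)
open import Data.List.Relation.Binary.Permutation.Setoid.Properties using (AllPairs-resp-↭)
open import Data.List.Relation.Unary.All as All using (All; []; _∷_)
import Data.List.Relation.Unary.All.Properties as All
open import Data.List.Relation.Unary.Any using (Any; here; there)
import Data.List.Relation.Unary.Any.Properties as Any
open import Data.List.Relation.Unary.AllPairs using (AllPairs; []; _∷_)
import Data.List.Relation.Unary.AllPairs.Properties as AllPairs
open import Data.Product using (_×_; _,_; proj₁; proj₂; ∃-syntax)
open import Data.Sum using (_⊎_; inj₁; inj₂; [_,_]′)
open import Function using (_∘_; mk⇔)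
open import Level using (0ℓ)
open import Relation.Binary.PropositionalEquality
  using (_≡_; _≢_; refl; sym; trans; cong; cong₂; subst; setoid; resp₂; module ≡-Reasoning)
open import Relation.Nullary using (¬_; yes; no; contradiction)
open import Relation.Unary using (Pred)

private variable
  A   : Set
  n m : ℕ

-- Row widths of lists of placements

width>0 : ∀ p → 0 < width p
width>0 (rect _ w) = >-nonZero⁻¹ w

rowWidth-hit : ∀ {i} (t : Placement n) ps → i ∈ᴵ proj₂ t →
               rowWidth (t ∷ ps) i ≡ width (proj₁ t) + rowWidth ps i
rowWidth-hit {i = i} t ps i∈t =
  cong (sum ∘ map (width ∘ proj₁)) (filter-accept ((i ∈ᴵ?_) ∘ proj₂) {t} {ps} i∈t)

rowWidth-miss : ∀ {i} (t : Placement n) ps → ¬ (i ∈ᴵ proj₂ t) →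
                rowWidth (t ∷ ps) i ≡ rowWidth ps i
rowWidth-miss {i = i} t ps i∉t =
  cong (sum ∘ map (width ∘ proj₁)) (filter-reject ((i ∈ᴵ?_) ∘ proj₂) {t} {ps} i∉t)

rowWidth-∷-≥ : ∀ (t : Placement n) ps i → rowWidth ps i ≤ rowWidth (t ∷ ps) i
rowWidth-∷-≥ t ps i with i ∈ᴵ? proj₂ t
... | yes i∈t = ≤-trans (m≤n+m _ (width (proj₁ t))) (≤-reflexive (sym (rowWidth-hit t ps i∈t)))
... | no  i∉t = ≤-reflexive (sym (rowWidth-miss t ps i∉t))

rowWidth-++ : ∀ (ps qs : List (Placement n)) i →
              rowWidth (ps ++ qs) i ≡ rowWidth ps i + rowWidth qs i
rowWidth-++ ps qs i = begin
  sum (map w (filter i? (ps ++ qs)))                   ≡⟨ cong (sum ∘ map w) (filter-++ i? ps qs) ⟩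
  sum (map w (filter i? ps ++ filter i? qs))           ≡⟨ cong sum (map-++ w (filter i? ps) _) ⟩
  sum (map w (filter i? ps) ++ map w (filter i? qs))   ≡⟨ sum-++ (map w (filter i? ps)) _ ⟩
  rowWidth ps i + rowWidth qs i                        ∎
  where
  open ≡-Reasoning
  w  = width ∘ proj₁
  i? = (i ∈ᴵ?_) ∘ proj₂

rowWidth-↭ : ∀ {ps qs : List (Placement n)} i → ps ↭ qs → rowWidth ps i ≡ rowWidth qs i
rowWidth-↭ i ps↭qs = sum-↭ (map⁺ _ (filter-↭ ((i ∈ᴵ?_) ∘ proj₂) ps↭qs))

-- Placed tiles, packings and their tilings

-- A placement whose columns are c + 1, …, c + width.
Placed : ℕ → Set
Placed n = Placement n × ℕ

Occupies : Placed n → Pred Cell 0ℓ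
Occupies ((p , ι) , c) (i , j) = i ∈ᴵ ι × c < j × j ≤ c + width p

Apart : Placed n → Placed n → Set
Apart x y = ∀ i j → Occupies x (i , j) → ¬ Occupies y (i , j)

Apart-sym : ∀ {x y : Placed n} → Apart x y → Apart y x
Apart-sym apart i j oy ox = apart i j ox oy

-- The bound depends on the row so that it can follow the uneven end of a stack; the constant bound
-- m gives the whole region.
Under : (ℕ → ℕ) → Pred (Placed n) 0ℓ
Under r x = ∀ i j → Occupies x (i , j) → 0 < j × j ≤ r i

-- All conditions are predicates on lists, so that they survive reordering. `within` bounds the
-- columns; the intervals themselves bound the rows.
record Packing (n m : ℕ) (Q : List (Placed n)) : Set where
  field
    within   : All (Under λ _ → m) Q
    covers   : ∀ i j → 1 ≤ i → i ≤ n → 0 < j → j ≤ m → Any (λ x → Occupies x (i , j)) Q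
    disjoint : AllPairs Apart Q

Packing-↭ : ∀ {Q Q′} → Q ↭ Q′ → Packing n m Q → Packing n m Q′
Packing-↭ Q↭Q′ k = record
  { within   = All-resp-↭ Q↭Q′ within
  ; covers   = λ i j 1≤i i≤n 0<j j≤m → Any-resp-↭ Q↭Q′ (covers i j 1≤i i≤n 0<j j≤m)
  ; disjoint = AllPairs-resp-↭ (setoid _) (λ {x y} → Apart-sym {x = x} {y}) (resp₂ _) (↭⇒↭ₛ Q↭Q′) disjoint
  }
  where open Packing k

-- Indexing by the length of `map proj₁ Q` gives the index type of a tiling by `map proj₁ Q` without
-- a cast.
placedAt : ∀ (Q : List (Placed n)) → Fin (length (map proj₁ Q)) → Placed n
placedAt (x ∷ Q) zero    = x
placedAt (x ∷ Q) (suc k) = placedAt Q k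

proj₁-placedAt : ∀ (Q : List (Placed n)) k → proj₁ (placedAt Q k) ≡ lookup (map proj₁ Q) k
proj₁-placedAt (x ∷ Q) zero    = refl
proj₁-placedAt (x ∷ Q) (suc k) = proj₁-placedAt Q k

All-placedAt : ∀ {R : Pred (Placed n) 0ℓ} {Q} → All R Q → ∀ k → R (placedAt Q k)
All-placedAt (r ∷ rs) zero    = r
All-placedAt (r ∷ rs) (suc k) = All-placedAt rs k

Any-placedAt : ∀ {R : Pred (Placed n) 0ℓ} {Q} → Any R Q → ∃[ k ] R (placedAt Q k)
Any-placedAt (here r)   = zero , r
Any-placedAt (there rs) = let k , r = Any-placedAt rs in suc k , r

AllPairs-placedAt : ∀ {R : Placed n → Placed n → Set} {Q} → (∀ {x y} → R x y → R y x) →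
                    AllPairs R Q → ∀ k l → k ≢ l → R (placedAt Q k) (placedAt Q l)
AllPairs-placedAt R-sym (r ∷ rs) zero    zero    k≢l = contradiction refl k≢l
AllPairs-placedAt R-sym (r ∷ rs) zero    (suc l) k≢l = All-placedAt r l
AllPairs-placedAt R-sym (r ∷ rs) (suc k) zero    k≢l = R-sym (All-placedAt r k)
AllPairs-placedAt R-sym (r ∷ rs) (suc k) (suc l) k≢l =
  AllPairs-placedAt R-sym rs k l (k≢l ∘ cong suc)

Fitting : Pred (Placement n) 0ℓ
Fitting (p , ι) = size ι ≡ height p

-- Rows and columns count from 1: a shift by `first ι ∸ 1` takes row 1 to row `first ι`, and a shift
-- by c makes c + 1 the first column.
corner : Placed n → ℕ × ℕ
corner ((p , ι) , c) = first ι ∸ 1 , c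

tile⇒Occupies : ∀ (x : Placed n) → Fitting (proj₁ x) → ∀ {i j} →
                translate (corner x) (cells (proj₁ (proj₁ x))) (i , j) → Occupies x (i , j)
tile⇒Occupies ((p , interval (suc f) l _ f<l _) , c) h (i , j , ((1≤i , i≤h) , 1≤j , j≤w) , refl) =
  ( ≤-trans (≤-reflexive (+-comm 1 f)) (+-monoʳ-≤ f 1≤i)
  , ≤-trans (+-monoʳ-≤ f i≤h) (≤-reflexive (trans (cong (f +_) (sym h)) (m+[n∸m]≡n (<⇒≤ f<l)))) )
  , ≤-trans (≤-reflexive (+-comm 1 c)) (+-monoʳ-≤ c 1≤j)
  , +-monoʳ-≤ c j≤w

Occupies⇒tile : ∀ (x : Placed n) → Fitting (proj₁ x) → ∀ {i j} →
                Occupies x (i , j) → translate (corner x) (cells (proj₁ (proj₁ x))) (i , j)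
Occupies⇒tile ((p , interval (suc f) l _ _ _) , c) h {i} {j} ((f<i , i≤l) , c<j , j≤c+w) =
  i ∸ f , j ∸ c ,
  ( (m<n⇒0<n∸m f<i , ≤-trans (∸-monoˡ-≤ f i≤l) (≤-reflexive h))
  , m<n⇒0<n∸m c<j , m≤n+o⇒m∸n≤o j c j≤c+w ) ,
  cong₂ _,_ (sym (m+[n∸m]≡n (<⇒≤ f<i))) (sym (m+[n∸m]≡n (<⇒≤ c<j)))

Packing⇒Tiling : ∀ (Q : List (Placed n)) → All Fitting (map proj₁ Q) → Packing n m Q →
                 Tiling n m (map proj₁ Q)
Packing⇒Tiling {n} {m} Q fits pk = record
  { shift    = shift′
  ; covers   = (λ (k , x∈k) → inside k (to k x∈k))
             , λ {(i , j)} ((1≤i , i≤n) , 1≤j , j≤m) →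
                 let k , o = Any-placedAt (covers i j 1≤i i≤n 1≤j j≤m) in k , from k o
  ; disjoint = λ k l k≢l (x∈k , x∈l) →
      AllPairs-placedAt (λ {x y} → Apart-sym {x = x} {y}) disjoint k l k≢l _ _ (to k x∈k) (to l x∈l)
  ; rows     = λ k i → mk⇔
      (λ (j , x∈k) → subst (λ t → i ∈ᴵ proj₂ t) (proj₁-placedAt Q k) (proj₁ (to k x∈k)))
      (λ i∈k → let c = proj₂ (placedAt Q k)
                   p = proj₁ (proj₁ (placedAt Q k)) in
        -- The witness is the last column of the tile; it lies beyond c because widths are positive.
        c + width p , from k
          ( subst (λ t → i ∈ᴵ proj₂ t) (sym (proj₁-placedAt Q k)) i∈k
          , m<m+n c (width>0 p) , ≤-refl))
  }
  where
  open Packing pk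
  shift′ : Fin (length (map proj₁ Q)) → ℕ × ℕ
  shift′ k = corner (placedAt Q k)

  fit : ∀ k → Fitting (proj₁ (placedAt Q k))
  fit = All-placedAt (All.map⁻ fits)

  to : ∀ k {x} → translate (shift′ k) (cells (proj₁ (lookup (map proj₁ Q) k))) x →
       Occupies (placedAt Q k) x
  to k x∈k = tile⇒Occupies (placedAt Q k) (fit k)
    (subst (λ t → translate (shift′ k) (cells (proj₁ t)) _) (sym (proj₁-placedAt Q k)) x∈k)

  from : ∀ k {x} → Occupies (placedAt Q k) x →
         translate (shift′ k) (cells (proj₁ (lookup (map proj₁ Q) k))) x
  from k o = subst (λ t → translate (shift′ k) (cells (proj₁ t)) _) (proj₁-placedAt Q k)
    (Occupies⇒tile (placedAt Q k) (fit k) o)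

  inside : ∀ k {x} → Occupies (placedAt Q k) x → Region n m x
  inside k {i , j} o@((f≤i , i≤l) , _) =
    let ι = proj₂ (proj₁ (placedAt Q k)) in
    (≤-trans (1≤first ι) f≤i , ≤-trans i≤l (last≤n ι)) , All-placedAt within k i j o

-- Flush stacks at the left edge

Level : ℕ → ℕ → List (Placement n) → Set
Level a b ps = ∀ i k → a ≤ i × i ≤ b → a ≤ k × k ≤ b → rowWidth ps i ≡ rowWidth ps k

-- The head of the list is the tile stacked last.
data Flush {n} : List (Placement n) → Set where
  []  : Flush []
  _∷_ : ∀ {p ι ps} → Level (first ι) (last ι) ps → Flush ps → Flush ((p , ι) ∷ ps)

-- The offset is read off in the first row of the interval; in a `Flush` list every other row of the
-- interval gives the same value.
pushLeft : List (Placement n) → List (Placed n)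
pushLeft []             = []
pushLeft ((p , ι) ∷ ps) = ((p , ι) , rowWidth ps (first ι)) ∷ pushLeft ps

proj₁-pushLeft : ∀ (ps : List (Placement n)) → map proj₁ (pushLeft ps) ≡ ps
proj₁-pushLeft []       = refl
proj₁-pushLeft (t ∷ ps) = cong (t ∷_) (proj₁-pushLeft ps)

first∈ : ∀ (ι : Interval n) → first ι ∈ᴵ ι
first∈ ι = ≤-refl , first≤last ι

-- In each of its rows the newest tile ends exactly at the new row width, and the bounds for the
-- earlier tiles only grow.
pushLeft-within : ∀ {ps : List (Placement n)} → Flush ps → All (Under (rowWidth ps)) (pushLeft ps)
pushLeft-within [] = []
pushLeft-within {ps = (p , ι) ∷ ps} (flat ∷ fl) =
  (λ i j (i∈ι , c<j , j≤c+w) → ≤-trans z<s c<j , (begin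
    j                                ≤⟨ j≤c+w ⟩
    rowWidth ps (first ι) + width p  ≡⟨ cong (_+ width p) (flat (first ι) i (first∈ ι) i∈ι) ⟩
    rowWidth ps i + width p          ≡⟨ +-comm _ (width p) ⟩
    width p + rowWidth ps i          ≡⟨ rowWidth-hit (p , ι) ps i∈ι ⟨
    rowWidth ((p , ι) ∷ ps) i        ∎))
  ∷ All.map {P = Under (rowWidth ps)}
      (λ h i j o → let 0<j , j≤ = h i j o in 0<j , ≤-trans j≤ (rowWidth-∷-≥ (p , ι) ps i))
      (pushLeft-within fl)
  where open ≤-Reasoning

pushLeft-covers : ∀ {ps : List (Placement n)} → Flush ps → ∀ i j → 0 < j → j ≤ rowWidth ps i →
                  Any (λ x → Occupies x (i , j)) (pushLeft ps)
pushLeft-covers [] i j 0<j j≤0 = contradiction (≤-trans 0<j j≤0) λ ()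
pushLeft-covers {ps = t@(p , ι) ∷ ps} (flat ∷ fl) i j 0<j j≤ with j ≤? rowWidth ps i
... | yes j≤′ = there (pushLeft-covers fl i j 0<j j≤′)
... | no  j≰  with i ∈ᴵ? ι
-- Row i has not grown, so j would already be within the old width.
...   | no  i∉ι = contradiction (≤-trans j≤ (≤-reflexive (rowWidth-miss t ps i∉ι))) j≰
...   | yes i∈ι = here (i∈ι , subst (_< j) (sym eq) (≰⇒> j≰) , (begin
    j                                ≤⟨ j≤ ⟩
    rowWidth (t ∷ ps) i              ≡⟨ rowWidth-hit t ps i∈ι ⟩
    width p + rowWidth ps i          ≡⟨ +-comm (width p) _ ⟩
    rowWidth ps i + width p          ≡⟨ cong (_+ width p) eq ⟨
    rowWidth ps (first ι) + width p  ∎))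
  where
  open ≤-Reasoning
  eq = flat (first ι) i (first∈ ι) i∈ι

pushLeft-disjoint : ∀ {ps : List (Placement n)} → Flush ps →
                    AllPairs Apart (pushLeft ps)
pushLeft-disjoint [] = []
pushLeft-disjoint {ps = (p , ι) ∷ ps} (flat ∷ fl) =
  All.map {P = Under (rowWidth ps)} (λ h i j (i∈ι , c<j , _) o →
            <⇒≱ c<j (≤-trans (proj₂ (h i j o)) (≤-reflexive (flat i (first ι) i∈ι (first∈ ι)))))
          (pushLeft-within fl)
  ∷ pushLeft-disjoint fl

-- Mirror images and stacks at the right edge

-- Column j goes to m + 1 - j. The truncated subtraction is exact for tiles with `rightEnd x ≤ m`.
reflect : ℕ → Placed n → Placed n
reflect m ((p , ι) , c) = (p , ι) , m ∸ (c + width p)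

rightEnd : Placed n → ℕ
rightEnd ((p , ι) , c) = c + width p

-- The form of every column inequality in the mirroring: mirror columns have a fixed sum, so an
-- upper bound on one is a lower bound on the other.
exchange-≤ : ∀ {a b c d} → a + b ≡ c + d → d ≤ b → a ≤ c
exchange-≤ {a} {b} {c} {d} eq d≤b =
  +-cancelʳ-≤ d a c (≤-trans (+-monoʳ-≤ a d≤b) (≤-reflexive eq))

module _ {x : Placed n} (fits : rightEnd x ≤ m) {i j j′ : ℕ} (mirror : j + j′ ≡ suc m) where
  private
    w = width (proj₁ (proj₁ x))
    c = proj₂ x
    d = m ∸ (c + w)

    -- Mirror columns add up to m + 1. Here these are the first column of the image and the last of
    -- the tile; in `total₂`, the first of the tile and the last of the image.
    total₁ : suc d + (c + w) ≡ j + j′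
    total₁ = trans (cong suc (m∸n+n≡m fits)) (sym mirror)

    swap : ∀ c d w → suc c + (d + w) ≡ suc d + (c + w)
    swap = solve-∀

    total₂ : suc c + (d + w) ≡ j + j′
    total₂ = trans (swap c d w) total₁

  reflect-Occupies⁺ : Occupies x (i , j) → Occupies (reflect m x) (i , j′)
  reflect-Occupies⁺ (i∈ι , c<j , j≤c+w) =
    i∈ι , exchange-≤ (trans total₁ (+-comm j j′)) j≤c+w
        , exchange-≤ (trans (+-comm j′ j) (trans (sym total₂) (+-comm (suc c) (d + w)))) c<j

  reflect-Occupies⁻ : Occupies (reflect m x) (i , j′) → Occupies x (i , j)
  reflect-Occupies⁻ (i∈ι , d<j′ , j′≤d+w) =
    i∈ι , exchange-≤ total₂ j′≤d+w
        , exchange-≤ (trans (sym total₁) (+-comm (suc d) (c + w))) d<j′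

-- Mirroring is shown to preserve `Apart` for tiles that end by column m, so the map over pairs has
-- access to a property of each entry.
AllPairs-map-All : ∀ {P : Pred A 0ℓ} {R S : A → A → Set} → (∀ {x y} → P x → P y → R x y → S x y) →
                   ∀ {xs} → All P xs → AllPairs R xs → AllPairs S xs
AllPairs-map-All f []         []         = []
AllPairs-map-All f (px ∷ pxs) (rx ∷ rxs) =
  All.zipWith (λ (py , r) → f px py r) (pxs , rx) ∷ AllPairs-map-All f pxs rxs

pushRight : ℕ → List (Placement n) → List (Placed n)
pushRight m ps = map (reflect m) (pushLeft ps)

-- Mirror image of `Under`: `m < j + r i` puts j among the last `r i` columns of row i, without
-- subtraction.
Beyond : ℕ → (ℕ → ℕ) → Pred (Placed n) 0ℓ
Beyond m r x = ∀ i j → Occupies x (i , j) → (0 < j × j ≤ m) × m < j + r i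

module _ {ps : List (Placement n)} (fl : Flush ps)
         (bound : ∀ i → 1 ≤ i → i ≤ n → rowWidth ps i ≤ m) where

  pushLeft-rightEnd : All (λ x → rightEnd x ≤ m) (pushLeft ps)
  pushLeft-rightEnd = All.map
    (λ { {(p , ι) , c} h → ≤-trans
         (proj₂ (h (first ι) (c + width p)
           (first∈ ι , m<m+n c (width>0 p) , ≤-refl)))
         (bound (first ι) (1≤first ι) (≤-trans (first≤last ι) (last≤n ι))) })
    (pushLeft-within fl)

  mirrored : ∀ (x : Placed n) → rightEnd x ≤ m → ∀ i j → Occupies (reflect m x) (i , j) →
             j ≤ m × Occupies x (i , suc m ∸ j)
  mirrored x@((p , ι) , c) fits i j o@(_ , _ , j≤d+w) =
    j≤m , reflect-Occupies⁻ {x = x} fits (m∸n+n≡m (m≤n⇒m≤1+n j≤m)) o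
    where
    -- This makes `suc m ∸ j` an exact difference, the mirror column of j.
    j≤m : j ≤ m
    j≤m = ≤-trans j≤d+w (≤-trans (+-monoʳ-≤ (m ∸ (c + width p)) (m≤n+m (width p) c))
                                 (≤-reflexive (m∸n+n≡m fits)))

  pushRight-within : All (Beyond m (rowWidth ps)) (pushRight m ps)
  pushRight-within = All.map⁺ (All.zipWith {P = λ x → rightEnd x ≤ m} {Q = Under (rowWidth ps)}
    (λ {x} (fits , h) i j o →
      let j≤m , o′ = mirrored x fits i j o
          _ , j′≤  = h i (suc m ∸ j) o′ in
      (≤-trans z<s (proj₁ (proj₂ o)) , j≤m) ,
      ≤-trans (≤-reflexive (sym (m+[n∸m]≡n (m≤n⇒m≤1+n j≤m)))) (+-monoʳ-≤ j j′≤))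
    (pushLeft-rightEnd , pushLeft-within fl))

  pushRight-covers : ∀ i j → j ≤ m → m < j + rowWidth ps i →
                     Any (λ x → Occupies x (i , j)) (pushRight m ps)
  pushRight-covers i j j≤m m<j+r = Any.map⁺ (lookup-with pushLeft-rightEnd
    (λ {x} fits → reflect-Occupies⁺ {x = x} fits (m∸n+n≡m (m≤n⇒m≤1+n j≤m)))
    (pushLeft-covers fl i (suc m ∸ j) (m<n⇒0<n∸m (s≤s j≤m)) (m≤n+o⇒m∸n≤o (suc m) j m<j+r)))
    where
    lookup-with : ∀ {P Q R : Pred (Placed n) 0ℓ} {xs} → All P xs → (∀ {x} → P x → Q x → R x) →
                  Any Q xs → Any R xs
    lookup-with (px ∷ pxs) f (here qx)   = here (f px qx)
    lookup-with (px ∷ pxs) f (there qxs) = there (lookup-with pxs f qxs)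

  pushRight-disjoint : AllPairs Apart (pushRight m ps)
  pushRight-disjoint = AllPairs.map⁺ (AllPairs-map-All
    (λ {x} {y} fitsx fitsy apart i j ox oy →
      apart i (suc m ∸ j) (proj₂ (mirrored x fitsx i j ox)) (proj₂ (mirrored y fitsy i j oy)))
    pushLeft-rightEnd (pushLeft-disjoint fl))

-- Two stacks filling the region

Flush⇒Packing : ∀ {ps qs : List (Placement n)} → Flush ps → Flush qs →
                (∀ i → 1 ≤ i → i ≤ n → rowWidth ps i + rowWidth qs i ≡ m) →
                Packing n m (pushLeft ps ++ pushRight m qs)
Flush⇒Packing {n} {m} {ps} {qs} flₚ fl total = record
  { within   = All.++⁺
      (All.map {P = Under (rowWidth ps)} (λ {x} h i j o → let 0<j , j≤ = h i j o in
                  0<j , ≤-trans j≤ (m+n≤o⇒m≤o _ (≤-reflexive (total′ x o))))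
               (pushLeft-within flₚ))
      (All.map {P = Beyond m (rowWidth qs)} (λ h i j o → proj₁ (h i j o)) (pushRight-within fl bound))
  ; covers   = covers
  ; disjoint = AllPairs.++⁺ (pushLeft-disjoint flₚ) (pushRight-disjoint fl bound)
      (All.map {P = Under (rowWidth ps)} (λ {x} h → All.map {P = Beyond m (rowWidth qs)} (λ h′ i j o o′ →
          -- A cell in both stacks would give m < j + `rowWidth qs i`, while j ≤ `rowWidth ps i`
          -- makes that sum at most m.
          <⇒≱ (proj₂ (h′ i j o′)) (≤-trans (+-monoˡ-≤ (rowWidth qs i) (proj₂ (h i j o)))
                                           (≤-reflexive (total′ x o))))
        (pushRight-within fl bound)) (pushLeft-within flₚ))
  }
  where
  bound : ∀ i → 1 ≤ i → i ≤ n → rowWidth qs i ≤ m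
  bound i 1≤i i≤n = m+n≤o⇒n≤o (rowWidth ps i) (≤-reflexive (total i 1≤i i≤n))

  total′ : ∀ (x : Placed n) {i j} → Occupies x (i , j) → rowWidth ps i + rowWidth qs i ≡ m
  total′ ((p , ι) , c) ((f≤i , i≤l) , _) =
    total _ (≤-trans (1≤first ι) f≤i) (≤-trans i≤l (last≤n ι))

  covers : ∀ i j → 1 ≤ i → i ≤ n → 0 < j → j ≤ m → Any (λ x → Occupies x (i , j)) _
  covers i j 1≤i i≤n 0<j j≤m with j ≤? rowWidth ps i
  ... | yes j≤ = Any.++⁺ˡ (pushLeft-covers flₚ i j 0<j j≤)
  -- As j exceeds `rowWidth ps i`, it is among the last `rowWidth qs i` columns.
  ... | no  j≰ = Any.++⁺ʳ (pushLeft ps) (pushRight-covers fl bound i j j≤m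
    (≤-trans (≤-reflexive (cong suc (sym (total i 1≤i i≤n)))) (+-monoˡ-≤ (rowWidth qs i) (≰⇒> j≰))))

proj₁-pushes : ∀ m (ps qs : List (Placement n)) →
               map proj₁ (pushLeft ps ++ pushRight m qs) ≡ ps ++ qs
proj₁-pushes m ps qs = begin
  map proj₁ (pushLeft ps ++ pushRight m qs)
    ≡⟨ map-++ proj₁ (pushLeft ps) _ ⟩
  map proj₁ (pushLeft ps) ++ map proj₁ (pushRight m qs)
    ≡⟨ cong₂ _++_ (proj₁-pushLeft ps) (sym (map-∘ (pushLeft qs))) ⟩
  ps ++ map proj₁ (pushLeft qs)
    ≡⟨ cong (ps ++_) (proj₁-pushLeft qs) ⟩
  ps ++ qs ∎
  where open ≡-Reasoning

Flush⇒Tiling : ∀ {P ps qs : List (Placement n)} → P ↭ ps ++ qs → Flush ps → Flush qs →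
               All Fitting P → (∀ i → 1 ≤ i → i ≤ n → rowWidth P i ≡ m) → Tiling n m P
Flush⇒Tiling {n} {m} {P} {ps} {qs} P↭ flₚ fl fits rows
  -- The tiling is indexed by P in its given order. Lifting the permutation along `proj₁` lets every
  -- placement keep its column while the list is reordered.
  with Q , refl , Q′↭Q ← ↭-map-inv proj₁ (↭-trans (↭-reflexive (proj₁-pushes m ps qs)) (↭-sym P↭))
  = Packing⇒Tiling Q fits (Packing-↭ Q′↭Q (Flush⇒Packing flₚ fl λ i 1≤i i≤n →
      trans (sym (trans (rowWidth-↭ i P↭) (rowWidth-++ ps qs i))) (rows i 1≤i i≤n)))

-- Stacks built in layers

Spans : ℕ → ℕ → Pred (Placement n) 0ℓ
Spans a b (p , ι) = first ι ≡ a × last ι ≡ b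

SingleRow : Pred (Placement n) 0ℓ
SingleRow (p , ι) = first ι ≡ last ι

-- The invariant of the construction: `Level a b` lets the next tile be any whose interval lies
-- within rows a, ..., b.
Stack : ℕ → ℕ → List (Placement n) → Set
Stack a b ps = Flush ps × Level a b ps

empty : ∀ {a b} → Stack {n} a b []
empty = [] , λ _ _ _ _ → refl

narrow : ∀ {a b a′ b′} {ps : List (Placement n)} → a ≤ a′ → b′ ≤ b → Stack a b ps → Stack a′ b′ ps
narrow a≤a′ b′≤b (fl , level) = fl , λ i k (a′≤i , i≤b′) (a′≤k , k≤b′) →
  level i k (≤-trans a≤a′ a′≤i , ≤-trans i≤b′ b′≤b) (≤-trans a≤a′ a′≤k , ≤-trans k≤b′ b′≤b)

-- Each tile lengthens all rows from a to b by its own width, so the end stays flat there for the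
-- next one.
layer : ∀ {a b} {ts ps : List (Placement n)} → All (Spans a b) ts → Stack a b ps → Stack a b (ts ++ ps)
layer [] st = st
layer {ts = t@(p , ι) ∷ ts} {ps} ((refl , refl) ∷ sp) st with fl , level ← layer sp st =
  level ∷ fl , λ i k i∈ k∈ → begin
    rowWidth (t ∷ ts ++ ps) i        ≡⟨ rowWidth-hit t (ts ++ ps) i∈ ⟩
    width p + rowWidth (ts ++ ps) i  ≡⟨ cong (width p +_) (level i k i∈ k∈) ⟩
    width p + rowWidth (ts ++ ps) k  ≡⟨ rowWidth-hit t (ts ++ ps) k∈ ⟨
    rowWidth (t ∷ ts ++ ps) k        ∎
  where open ≡-Reasoning

-- A single row is always flat, so these tiles go on any flush stack; they may leave its end ragged
-- and therefore come last.
layer-rows : ∀ {ts ps : List (Placement n)} → All SingleRow ts → Flush ps → Flush (ts ++ ps)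
layer-rows [] fl = fl
layer-rows {ts = (p , ι) ∷ ts} {ps} (refl ∷ single) fl =
  (λ i k (f≤i , i≤f) (f≤k , k≤f) →
     cong (rowWidth (ts ++ ps)) (trans (≤-antisym i≤f f≤i) (≤-antisym f≤k k≤f)))
  ∷ layer-rows single fl

split : ∀ {P Q : Pred A 0ℓ} {xs} → All (λ x → P x ⊎ Q x) xs →
        ∃[ ys ] ∃[ zs ] xs ↭ ys ++ zs × All P ys × All Q zs
split [] = [] , [] , ↭-refl , [] , []
split (inj₁ p ∷ r) =
  let ys , zs , eq , ps , qs = split r in _ ∷ ys , zs , ↭-prep _ eq , p ∷ ps , qs
split (inj₂ q ∷ r) =
  let ys , zs , eq , ps , qs = split r in
  ys , _ ∷ zs , ↭-trans (↭-prep _ eq) (↭-sym (shift _ ys zs)) , ps , q ∷ qs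

module _ {A : Set} where
  open import Algebra.Solver.CommutativeMonoid (++-commutativeMonoid {A = A})
    using (solve; _⊜_; _⊕_; id)

  -- The tiles are: s single rows, t rows 1 to n - 1, f full height, b rows 2 to n. The right-hand
  -- side lists the left stack, then the right one, latest tiles first; each `[]` is an `empty`
  -- stack.
  rearrange-top : ∀ (s t f b : List A) → s ++ t ++ f ++ b ↭ (s ++ t ++ f ++ []) ++ b ++ []
  rearrange-top =
    solve 4 (λ s t f b → s ⊕ (t ⊕ (f ⊕ b)) ⊜ (s ⊕ (t ⊕ (f ⊕ id))) ⊕ (b ⊕ id)) ↭-refl

  -- Gathers at the front what `pairUp` consumes: x on rows 1, 2, z on rows 3, 4, and the full tiles
  -- f. The tiles y are those on rows 2, 3.
  rearrange-pairs : ∀ (s f t b y x z : List A) → s ++ f ++ t ++ b ++ y ++ x ++ z ↭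
                    (x ++ z ++ f ++ []) ++ s ++ t ++ b ++ y
  rearrange-pairs = solve 7
    (λ s f t b y x z → s ⊕ (f ⊕ (t ⊕ (b ⊕ (y ⊕ (x ⊕ z))))) ⊜
                       (x ⊕ (z ⊕ (f ⊕ id))) ⊕ (s ⊕ (t ⊕ (b ⊕ y)))) ↭-refl

  rearrange-upper : ∀ (r g s t b y : List A) →
                    (r ++ g) ++ s ++ t ++ b ++ y ↭ (s ++ r ++ t ++ g) ++ y ++ b ++ []
  rearrange-upper = solve 6
    (λ r g s t b y → (r ⊕ g) ⊕ (s ⊕ (t ⊕ (b ⊕ y))) ⊜ (s ⊕ (r ⊕ (t ⊕ g))) ⊕ (y ⊕ (b ⊕ id))) ↭-refl

  rearrange-lower : ∀ (r g s t b y : List A) →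
                    (r ++ g) ++ s ++ t ++ b ++ y ↭ (s ++ y ++ t ++ g) ++ r ++ b ++ []
  rearrange-lower = solve 6
    (λ r g s t b y → (r ⊕ g) ⊕ (s ⊕ (t ⊕ (b ⊕ y))) ⊜ (s ⊕ (y ⊕ (t ⊕ g))) ⊕ (r ⊕ (b ⊕ id))) ↭-refl

  rearrange-cons : ∀ x z (xs zs g : List A) → (x ∷ xs) ++ (z ∷ zs) ++ g ↭ xs ++ zs ++ z ∷ x ∷ g
  rearrange-cons x z xs zs g =
    solve 5 (λ x z xs zs g → (x ⊕ xs) ⊕ ((z ⊕ zs) ⊕ g) ⊜ xs ⊕ (zs ⊕ (z ⊕ (x ⊕ g)))) ↭-refl
      (x ∷ []) (z ∷ []) xs zs g

-- Heights 1 and at least n - 1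

-- At most one row is missing from an interval of at least n - 1 rows, and it must be row 1 or row
-- n.
classify : ∀ {L} (t : Placement n) → Admissible L t →
           height (proj₁ t) ≡ 1 ⊎ n ∸ 1 ≤ height (proj₁ t) →
           SingleRow t ⊎ Spans 1 (n ∸ 1) t ⊎ Spans 1 n t ⊎ Spans 2 n t
classify (p , interval f l _ f≤l _) (_ , size≡h) (inj₁ h≡1) =
  inj₁ (≤-antisym f≤l (m∸n≡0⇒m≤n (suc-injective (begin
    suc (l ∸ f)  ≡⟨ +-∸-assoc 1 f≤l ⟨
    suc l ∸ f    ≡⟨ trans size≡h h≡1 ⟩
    1            ∎))))
  where open ≡-Reasoning
classify {suc n} (p , interval 1 l _ _ l≤n) (_ , refl) (inj₂ n≤h) with m≤n⇒m<n∨m≡n l≤n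
... | inj₁ (s≤s l≤n′) = inj₂ (inj₁ (refl , ≤-antisym l≤n′ n≤h))
... | inj₂ l≡n        = inj₂ (inj₂ (inj₁ (refl , l≡n)))
classify {suc n} (p , interval 2 (suc l) _ _ l≤n) (_ , refl) (inj₂ n≤h) =
  inj₂ (inj₂ (inj₂ (refl , ≤-antisym l≤n (s≤s n≤h))))
-- Rows 1 and 2 are both missing, so the height is too small.
classify {suc n} (p , interval (suc (suc (suc f))) (suc (suc l)) _ _ (s≤s l<n)) (_ , refl) (inj₂ n≤h) =
  contradiction (≤-trans l<n n≤h) (<⇒≱ (s≤s (m∸n≤m l f)))
classify {zero} (p , interval (suc f) zero _ () _) _ (inj₂ _)

representable-height-1-or-≥n∸1 : ∀ n (L : List RectPolyomino) →
  (∀ p → p ∈ L → height p ≡ 1 ⊎ n ∸ 1 ≤ height p) → Representable n L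
representable-height-1-or-≥n∸1 n L heights m P adm _ rows =
  let s , r₁ , P↭ , single , sp₁ =
        split (All.map (λ {t} a → classify t a (heights _ (proj₁ a))) adm)
      t , r₂ , r₁↭ , top    , sp₂ = split sp₁
      f , b  , r₂↭ , full , bottom = split sp₂
  in Flush⇒Tiling
      (↭-trans P↭ (↭-trans (++⁺ˡ s (↭-trans r₁↭ (++⁺ˡ t r₂↭))) (rearrange-top s t f b)))
      (layer-rows single (proj₁ (layer top (narrow ≤-refl (m∸n≤m n 1) (layer full empty)))))
      (proj₁ (layer bottom empty))
      (All.map proj₂ adm) rows

-- Four rows

-- The two tiles share no row, so each meets the flat end of g; equal widths make the end flat again
-- on all four rows.
stack-pair : ∀ {x z : Placement 4} {g} → Spans 1 2 x → Spans 3 4 z →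
             width (proj₁ x) ≡ width (proj₁ z) → Stack 1 4 g → Stack 1 4 (z ∷ x ∷ g)
stack-pair {x@(p , _)} {z@(q , _)} {g} (refl , refl) (refl , refl) p≡q (fl , level) =
  level-z ∷ level-x ∷ fl , λ i k i∈ k∈ → begin
    rowWidth (z ∷ x ∷ g) i   ≡⟨ pair-width i i∈ ⟩
    width p + rowWidth g i   ≡⟨ cong (width p +_) (level i k i∈ k∈) ⟩
    width p + rowWidth g k   ≡⟨ pair-width k k∈ ⟨
    rowWidth (z ∷ x ∷ g) k   ∎
  where
  open ≡-Reasoning

  level-x : Level 1 2 g
  level-x = proj₂ (narrow ≤-refl (m≤m+n 2 2) (fl , level))

  miss-x : ∀ {i} → 3 ≤ i → rowWidth (x ∷ g) i ≡ rowWidth g i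
  miss-x 3≤i = rowWidth-miss x g (λ (_ , i≤2) → <⇒≱ 3≤i i≤2)

  level-z : Level 3 4 (x ∷ g)
  level-z i k (3≤i , i≤4) (3≤k , k≤4) = begin
    rowWidth (x ∷ g) i  ≡⟨ miss-x 3≤i ⟩
    rowWidth g i        ≡⟨ level i k (≤-trans (m≤m+n 1 2) 3≤i , i≤4) (≤-trans (m≤m+n 1 2) 3≤k , k≤4) ⟩
    rowWidth g k        ≡⟨ miss-x 3≤k ⟨
    rowWidth (x ∷ g) k  ∎

  pair-width : ∀ i → 1 ≤ i × i ≤ 4 → rowWidth (z ∷ x ∷ g) i ≡ width p + rowWidth g i
  pair-width i (1≤i , i≤4) with i ≤? 2
  ... | yes i≤2 = trans (rowWidth-miss z (x ∷ g) (λ (3≤i , _) → <⇒≱ 3≤i i≤2))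
                        (rowWidth-hit x g (1≤i , i≤2))
  ... | no  i≰2 = trans (rowWidth-hit z (x ∷ g) (≰⇒> i≰2 , i≤4))
                        (cong₂ _+_ (sym p≡q) (miss-x (≰⇒> i≰2)))

-- Pairs are stacked until one kind runs out, so the remainder r is all of the other kind. `W`
-- stands for whatever forces equal widths.
pairUp : ∀ {W : Pred RectPolyomino 0ℓ} → (∀ p q → W p → W q → width p ≡ width q) →
         ∀ {xs zs g : List (Placement 4)} →
         All (λ x → Spans 1 2 x × W (proj₁ x)) xs →
         All (λ z → Spans 3 4 z × W (proj₁ z)) zs →
         Stack 1 4 g →
         ∃[ r ] ∃[ g′ ] xs ++ zs ++ g ↭ r ++ g′ × Stack 1 4 g′ × (All (Spans 1 2) r ⊎ All (Spans 3 4) r)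
pairUp same {zs = zs} {g} []  zsp st = zs , g , ↭-refl , st , inj₂ (All.map proj₁ zsp)
pairUp same {xs} {[]} {g} xsp []  st = xs , g , ↭-refl , st , inj₁ (All.map proj₁ xsp)
pairUp same {x ∷ xs} {z ∷ zs} {g} ((x-spans , Wx) ∷ xsp) ((z-spans , Wz) ∷ zsp) st =
  let r , g′ , eq , rest = pairUp same xsp zsp
        (stack-pair {x} {z} x-spans z-spans (same _ _ Wx Wz) st)
  in r , g′ , ↭-trans (rearrange-cons x z xs zs g) eq , rest

-- `W` accompanies the tiles on rows 1, 2 and on rows 3, 4, whose widths `pairUp` compares.
classify₄ : ∀ {L} (t : Placement 4) → Admissible L t → let W = λ p → p ∈ L × height p ≡ 2 in
            SingleRow t ⊎ Spans 1 4 t ⊎ Spans 1 3 t ⊎ Spans 2 4 t ⊎ Spans 2 3 t ⊎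
            (Spans 1 2 t × W (proj₁ t)) ⊎ (Spans 3 4 t × W (proj₁ t))
classify₄ (p , interval 1 1 _ _ _) _       = inj₁ refl
classify₄ (p , interval 2 2 _ _ _) _       = inj₁ refl
classify₄ (p , interval 3 3 _ _ _) _       = inj₁ refl
classify₄ (p , interval 4 4 _ _ _) _       = inj₁ refl
classify₄ (p , interval 1 4 _ _ _) _       = inj₂ (inj₁ (refl , refl))
classify₄ (p , interval 1 3 _ _ _) _       = inj₂ (inj₂ (inj₁ (refl , refl)))
classify₄ (p , interval 2 4 _ _ _) _       = inj₂ (inj₂ (inj₂ (inj₁ (refl , refl))))
classify₄ (p , interval 2 3 _ _ _) _       = inj₂ (inj₂ (inj₂ (inj₂ (inj₁ (refl , refl)))))
classify₄ (p , interval 1 2 _ _ _) (p∈ , h) =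
  inj₂ (inj₂ (inj₂ (inj₂ (inj₂ (inj₁ ((refl , refl) , p∈ , sym h))))))
classify₄ (p , interval 3 4 _ _ _) (p∈ , h) =
  inj₂ (inj₂ (inj₂ (inj₂ (inj₂ (inj₂ ((refl , refl) , p∈ , sym h))))))
-- The remaining intervals are empty or reach beyond row 4.
classify₄ (p , interval 2 1 _ (s≤s ()) _)
classify₄ (p , interval _ (suc (suc (suc (suc (suc _))))) _ _ (s≤s (s≤s (s≤s (s≤s ())))))
classify₄ (p , interval 3 1 _ (s≤s ()) _)
classify₄ (p , interval 3 2 _ (s≤s (s≤s ())) _)
classify₄ (p , interval (suc (suc (suc (suc _)))) 1 _ (s≤s ()) _)
classify₄ (p , interval (suc (suc (suc (suc _)))) 2 _ (s≤s (s≤s ())) _)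
classify₄ (p , interval (suc (suc (suc (suc _)))) 3 _ (s≤s (s≤s (s≤s ()))) _)
classify₄ (p , interval (suc (suc (suc (suc (suc _))))) 4 _ (s≤s (s≤s (s≤s (s≤s ())))) _)
classify₄ (p , interval (suc _) 0 _ () _)

representable-4 : ∀ (L : List RectPolyomino) →
  (∀ p q → p ∈ L → q ∈ L → height p ≡ 2 → height q ≡ 2 → width p ≡ width q) → Representable 4 L
representable-4 L same m P adm _ rows =
  let s , r₁ , P↭ , single , sp₁ = split (All.map (λ {t} → classify₄ t) adm)
      f , r₂ , r₁↭ , full , sp₂ = split sp₁
      t , r₃ , r₂↭ , top , sp₃ = split sp₂
      b , r₄ , r₃↭ , bottom , sp₄ = split sp₃
      y , r₅ , r₄↭ , mid , sp₅ = split sp₄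
      x , z , r₅↭ , upper , lower = split sp₅
      r , g , paired , base , rest =
        pairUp (λ p q (p∈ , hp) (q∈ , hq) → same p q p∈ q∈ hp hq) upper lower (layer full empty)
      P↭₁ = ↭-trans P↭ (++⁺ˡ s (↭-trans r₁↭ (++⁺ˡ f (↭-trans r₂↭ (++⁺ˡ t
              (↭-trans r₃↭ (++⁺ˡ b (↭-trans r₄↭ (++⁺ˡ y r₅↭)))))))))
      P↭₂ = ↭-trans P↭₁ (↭-trans (rearrange-pairs s f t b y x z)
              (++⁺ʳ (s ++ t ++ b ++ y) paired))
      -- `left` is flat on rows 1 to 3 and `right` on rows 2 to 4. Rows 2, 3 lie in both ranges, so
      -- the middle tiles can go on either side.
      left  = layer top (narrow ≤-refl (n≤1+n 3) base)
      right = layer bottom empty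
      fits  = All.map proj₂ adm
  in [ (λ upper′ → Flush⇒Tiling (↭-trans P↭₂ (rearrange-upper r g s t b y))
         (layer-rows single (proj₁ (layer upper′ (narrow ≤-refl (n≤1+n 2) left))))
         (proj₁ (layer mid (narrow ≤-refl (n≤1+n 3) right)))
         fits rows)
     -- Tiles on rows 3, 4 fit the flat end of `right`, so the middle tiles change over to the left.
     , (λ lower′ → Flush⇒Tiling (↭-trans P↭₂ (rearrange-lower r g s t b y))
         (layer-rows single (proj₁ (layer mid (narrow (n≤1+n 1) ≤-refl left))))
         (proj₁ (layer lower′ (narrow (n≤1+n 2) ≤-refl right)))
         fits rows)
     ]′ rest

theorem4p5 : (∀ (n : ℕ) (L : List RectPolyomino) →
    (∀ p → p ∈ L → height p ≡ 1 ⊎ n ∸ 1 ≤ height p) →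
    Representable n L)
    ×
    (∀ (L : List RectPolyomino) →
    (∀ p q → p ∈ L → q ∈ L → height p ≡ 2 → height q ≡ 2 → width p ≡ width q) →
    Representable 4 L)
theorem4p5 = representable-height-1-or-≥n∸1 , representable-4
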